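{- Let $n\ge4$. The number of friendship parking functions for the cycle graph $C_n$ is $$|\mathrm{FPF}(C_n)| = n+1+\sum_{i=1}^{n-2}(i+1)(i+2)+\sum_{i=1}^{3}(n+1-i)!\,(i-1)!+\sum_{i=4}^{n}\frac{(n-i+1)!\,i!}{3}.$$
   Context: $C_n$ is the cycle graph with vertex set $[n]=\{1,\dots,n\}$ and edges $\{i,i+1\}$ for $i\in[n-1]$ and $\{n,1\}$. Friendship parking process for a graph $G$ on $[n]$ and a parking preference $p\in[n]^n$: cars $1,\dots,n$ enter in order into spots $1,\dots,n$ (initially empty); spot $k$ is available for car $i$ if it is unoccupied when $i$ enters and each of spots $k-1,k+1$ is unoccupied or occupied by a car adjacent to $i$ in $G$ (spots $0,n+1$ count as unoccupied); car $i$ parks in the first available spot $k\ge p_i$, and fails to park if there is none. $\mathrm{FPF}(G)$ is the set of parking preferences for which all $n$ cars park. -}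

module Defs where

open import Data.Fin using (Fin; toℕ; _≤?_)
open import Data.Fin.Properties using (all?)
open import Data.List using (find; foldl; applyUpTo) renaming (allFin to allFinᴸ)
open import Data.Maybe using (Maybe; just; nothing; map; _>>=_; Is-just; Is-nothing)
import Data.Maybe.Relation.Unary.All as MaybeAll
open import Data.Nat as ℕ using (ℕ; suc; _+_; _∸_)
open import Data.Nat.ListAction using (sum)
import Data.Nat.Properties as ℕₚ
open import Data.Product using (Σ; _×_; _,_)
open import Data.Sum using (_⊎_; inj₁; inj₂; swap)
open import Data.Vec using (Vec; lookup; replicate; _[_]≔_)
open import Level using (0ℓ)
open import Relation.Binary using (Rel; Decidable; Symmetric)
open import Relation.Binary.PropositionalEquality using (_≡_; refl)
open import Relation.Nullary using (Dec; no; ¬_)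
open import Relation.Nullary.Decidable using (_×-dec_; _⊎-dec_; _→-dec_)

-- Finite simple graphs on [n].  Throughout, the element k of [n] is
-- represented by the element of Fin n whose toℕ is k - 1; this applies to
-- vertices, cars, spots and preferences alike.

record Graph (n : ℕ) : Set₁ where
  field
    Adj     : Rel (Fin n) 0ℓ
    adj?    : Decidable Adj
    adj-sym : Symmetric Adj
    irrefl  : ∀ i → ¬ Adj i i

Consecutive : ∀ {n} → Rel (Fin n) 0ℓ
Consecutive i j = suc (toℕ i) ≡ toℕ j ⊎ suc (toℕ j) ≡ toℕ i

consecutive? : ∀ {n} → Decidable (Consecutive {n})
consecutive? i j = (suc (toℕ i) ℕ.≟ toℕ j) ⊎-dec (suc (toℕ j) ℕ.≟ toℕ i)

-- That is, i = n and j = 1.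

LastFirst : ∀ {n} → Rel (Fin n) 0ℓ
LastFirst {n} i j = suc (toℕ i) ≡ n × toℕ j ≡ 0

lastFirst? : ∀ {n} → Decidable (LastFirst {n})
lastFirst? {n} i j = (suc (toℕ i) ℕ.≟ n) ×-dec (toℕ j ℕ.≟ 0)

CycleAdj : ∀ {n} → Rel (Fin n) 0ℓ
CycleAdj i j = Consecutive i j ⊎ (LastFirst i j ⊎ LastFirst j i)

cycleAdj-irrefl : ∀ {n} → 3 ℕ.≤ n → (i : Fin n) → ¬ CycleAdj i i
cycleAdj-irrefl 3≤n i (inj₁ (inj₁ e)) = ℕₚ.1+n≢n e
cycleAdj-irrefl 3≤n i (inj₁ (inj₂ e)) = ℕₚ.1+n≢n e
cycleAdj-irrefl 3≤n i (inj₂ q) = loop q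
  where
  n≢1 : ∀ {m} → 3 ℕ.≤ m → ¬ (1 ≡ m)
  n≢1 (ℕ.s≤s ()) refl

  bad : ¬ LastFirst i i
  bad (e , z) rewrite z = n≢1 3≤n e

  loop : ¬ (LastFirst i i ⊎ LastFirst i i)
  loop (inj₁ b) = bad b
  loop (inj₂ b) = bad b

cycle : (n : ℕ) → 3 ℕ.≤ n → Graph n
cycle n 3≤n = record
  { Adj     = CycleAdj
  ; adj?    = λ i j → consecutive? i j ⊎-dec (lastFirst? i j ⊎-dec lastFirst? j i)
  ; adj-sym = λ { (inj₁ c) → inj₁ (swap c) ; (inj₂ c) → inj₂ (swap c) }
  ; irrefl  = cycleAdj-irrefl 3≤n
  }

-- The occupant, if any, of each spot.

Lot : ℕ → Set
Lot n = Vec (Maybe (Fin n)) n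

Preference : ℕ → Set
Preference n = Vec (Fin n) n

module _ {n : ℕ} (G : Graph n) where
  open Graph G

  -- Spots 0 and n + 1 are not elements of Fin n, so, being always
  -- unoccupied, they impose no condition here.

  Available : Lot n → Fin n → Fin n → Set
  Available σ i k =
    Is-nothing (lookup σ k) ×
    (∀ j → Consecutive j k → MaybeAll.All (λ c → Adj c i) (lookup σ j))

  available? : ∀ σ i k → Dec (Available σ i k)
  available? σ i k =
    MaybeAll.dec (λ _ → no λ ()) (lookup σ k) ×-dec
    all? (λ j → consecutive? j k →-dec MaybeAll.dec (λ c → adj? c i) (lookup σ j))

  -- The list of spots is searched in increasing order.

  parkingSpot : Lot n → (car pref : Fin n) → Maybe (Fin n)
  parkingSpot σ i p = find (λ k → (p ≤? k) ×-dec available? σ i k) (allFinᴸ n)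

  park : Lot n → (car pref : Fin n) → Maybe (Lot n)
  park σ i p = map (λ k → σ [ k ]≔ just i) (parkingSpot σ i p)

  -- nothing means that some car has failed to park.

  outcome : Preference n → Maybe (Lot n)
  outcome p =
    foldl (λ s i → s >>= λ σ → park σ i (lookup p i))
          (just (replicate n nothing)) (allFinᴸ n)

  -- Is-just has at most one proof, so elements of FPF correspond exactly to
  -- the preferences for which all cars park.

  FPF : Set
  FPF = Σ (Preference n) λ p → Is-just (outcome p)

-- ∑[ i from a to b ] f i  =  f a + f (a + 1) + … + f b.

sumFromTo : ℕ → ℕ → (ℕ → ℕ) → ℕ
sumFromTo a b f = sum (applyUpTo (λ k → f (a + k)) (suc b ∸ a))

infix 5 sumFromTo
syntax sumFromTo a b (λ i → t) = ∑[ i from a to b ] t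

{-# OPTIONS --safe #-}
module Submission where

-- When all cars have parked, neighbouring spots hold cars that are adjacent in
-- the cycle, so the final arrangement is a Hamiltonian path of C_n: one of the n
-- rotations of 1, 2, …, n or one of the n rotations of n, …, 2, 1.  Given the
-- arrangement, the preferences of the cars are independent: a car may prefer its
-- own spot or any of the unavailable spots in an unbroken run just before it.
-- Hence an arrangement accounts for the product of these run lengths.
--
-- In the rotation m + 1, …, n, 1, …, m of 1, …, n, each car after m finds all
-- earlier spots occupied.  The cars up to m find the spots from car 1 onwards
-- occupied and, from car 3 onwards, the empty spot before car 1 closed to them,
-- which gives (n - m)! · 1 · 2 · 4 · 5 ⋯ (m + 1).  In the rotation
-- c, …, 1, n, …, c + 1 of n, …, 1, only the last two cars n - 1 and n can have
-- a choice, the former because it is not a friend of car 1.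

open import Defs
open import Data.Nat using (ℕ; zero; suc; _+_; _*_; _∸_; _/_; _≤_; _<_; _≤?_; _!; z≤n; s≤s; s≤s⁻¹)
open import Data.Nat.Properties
open import Algebra.Properties.CommutativeSemigroup +-commutativeSemigroup
  using (x∙yz≈y∙xz; xy∙z≈x∙zy; xy∙z≈xz∙y)
open import Data.Fin using (Fin; zero; suc; toℕ; fromℕ<; punchOut) renaming (_≤_ to _≤ᶠ_; _<_ to _<ᶠ_)
open import Data.Fin.Properties as Finₚ
  using (toℕ-injective; toℕ<n; any?; toℕ-fromℕ<; punchOut-injective; injective⇒≤; +↔⊎; *↔×; 1↔⊤)
open import Data.List using (find; foldl; tabulate; applyUpTo; []; _∷_)
open import Data.Maybe using (Maybe; just; nothing; _>>=_; Is-just; Is-nothing)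
import Data.Maybe.Relation.Unary.All as MaybeAll
import Data.Maybe.Relation.Unary.Any as MaybeAny
open import Data.Maybe.Properties using (just-injective)
open import Data.Nat.DivMod using (m*n/n≡m)
open import Data.Nat.ListAction using (sum; product)
open import Data.Nat.Tactic.RingSolver using (solve-∀)
open import Data.Product using (Σ; ∃; _×_; _,_; proj₁; proj₂)
open import Data.Product.Function.NonDependent.Propositional using (_×-↔_)
open import Data.Sum using (_⊎_; inj₁; inj₂; swap; [_,_]′)
open import Data.Sum.Function.Propositional using (_⊎-↔_)
open import Data.Unit using (⊤; tt)
open import Data.Vec as Vec using (lookup; replicate; _[_]≔_)
import Data.Vec.Functional as Vector
import Data.Vec.Functional.Properties as Vectorₚ
open import Data.Vec.Properties
  using (lookup∘updateAt; lookup∘updateAt′; lookup-replicate; lookup∘tabulate; tabulate∘lookup; tabulate-cong)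
open import Function using (_∘_; id; const; flip; Injective; StrictlySurjective)
open import Function.Bundles using (_⇔_; _↔_; mk⇔; mk⤖; mk↔ₛ′; Equivalence)
open import Function.Consequences.Propositional using (strictlySurjective⇒surjective)
open import Function.Construct.Composition using (_↔-∘_)
open import Function.Construct.Identity using (↔-id)
open import Function.Construct.Symmetry using (↔-sym)
open import Function.Properties.Bijection using (⤖⇒↔)
open import Level using (0ℓ)
open import Relation.Binary using (Rel)
open import Relation.Binary.Definitions using (tri<; tri≈; tri>)
open import Relation.Binary.PropositionalEquality
open import Relation.Nullary using (¬_; yes; no; contradiction)
open import Relation.Unary using (Pred; Decidable)

open Equivalence using () renaming (to to ⇒; from to ⇐)

-- First matches in tabulated lists

module _ {a p} {A : Set a} {P : Pred A p} (P? : Decidable P) where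

  find-tabulate⁺ : ∀ {m} (f : Fin m → A) k → P (f k) → (∀ j → j <ᶠ k → ¬ P (f j)) →
                   find P? (tabulate f) ≡ just (f k)
  find-tabulate⁺ {suc m} f k Pk first with P? (f zero) | k
  ... | yes P₀ | zero   = refl
  ... | yes P₀ | suc k′ = contradiction P₀ (first zero (s≤s z≤n))
  ... | no ¬P₀ | zero   = contradiction Pk ¬P₀
  ... | no ¬P₀ | suc k′ = find-tabulate⁺ (f ∘ suc) k′ Pk (λ j j<k → first (suc j) (s≤s j<k))

  find-tabulate⁻ : ∀ {m} (f : Fin m → A) {x} → find P? (tabulate f) ≡ just x →
                   ∃ λ k → f k ≡ x × P (f k) × (∀ j → j <ᶠ k → ¬ P (f j))
  find-tabulate⁻ {suc m} f eq with P? (f zero)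
  ... | yes P₀ = zero , just-injective eq , P₀ , λ _ ()
  ... | no ¬P₀ with find-tabulate⁻ (f ∘ suc) eq
  ...   | k , fk≡x , Pk , first = suc k , fk≡x , Pk ,
          λ { zero _ → ¬P₀ ; (suc j) (s≤s j<k) → first j j<k }

-- The parking process in terms of the spots of the cars

-- Parking is described by the map pos sending each car to its spot: when car i
-- enters, the occupied spots are those of the cars before i.

Free : ∀ {n} → Graph n → (Fin n → Fin n) → Fin n → Fin n → Set
Free G pos i k = ∀ c → c <ᶠ i → pos c ≢ k × (Consecutive (pos c) k → Graph.Adj G c i)

ParksAt : ∀ {n} → Graph n → (Fin n → Fin n) → (car pref spot : Fin n) → Set
ParksAt G pos i q k = q ≤ᶠ k × Free G pos i k × (∀ j → q ≤ᶠ j → j <ᶠ k → ¬ Free G pos i j)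

Parking : ∀ {n} → Graph n → (Fin n → Fin n) → Preference n → Set
Parking G pos p = ∀ i → ParksAt G pos i (lookup p i) (pos i)

AgreeBelow : ∀ {n} → ℕ → (Fin n → Fin n) → (Fin n → Fin n) → Set
AgreeBelow m pos pos′ = ∀ c → toℕ c < m → pos c ≡ pos′ c

module _ {n : ℕ} (G : Graph n) where

  -- Only the spots of cars before `i` enter into `Free`, so the map may be changed at `i` and at
  -- later cars.
  Free-cong : ∀ {pos pos′ i k} → AgreeBelow (toℕ i) pos pos′ → Free G pos i k → Free G pos′ i k
  Free-cong agree free c c<i rewrite sym (agree c c<i) = free c c<i

  ParksAt-cong : ∀ {pos pos′ i q k} → AgreeBelow (toℕ i) pos pos′ →
                 ParksAt G pos i q k → ParksAt G pos′ i q k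
  ParksAt-cong agree (q≤k , free , first) =
    q≤k , Free-cong agree free ,
    λ j q≤j j<k → first j q≤j j<k ∘ Free-cong (λ c c<i → sym (agree c c<i))

  ParksAt-deterministic : ∀ {pos i q k k′} → ParksAt G pos i q k → ParksAt G pos i q k′ → k ≡ k′
  ParksAt-deterministic {k = k} {k′} (q≤k , free , first) (q≤k′ , free′ , first′)
    with <-cmp (toℕ k) (toℕ k′)
  ... | tri< k<k′ _ _ = contradiction free (first′ k q≤k k<k′)
  ... | tri≈ _ k≡k′ _ = toℕ-injective k≡k′
  ... | tri> _ _ k′<k = contradiction free′ (first k′ q≤k′ k′<k)

  -- Induction along the cars: the preference of a car and the spots of the cars before it determine
  -- its own spot. Hence a preference belongs to at most one arrangement.
  Parking-unique : ∀ {pos pos′ p} → Parking G pos p → Parking G pos′ p → pos ≗ pos′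
  Parking-unique {pos} {pos′} {p} parks parks′ i = agreeBelow (suc (toℕ i)) i ≤-refl
    where
    agreeBelow : ∀ m → AgreeBelow m pos pos′
    agreeBelow (suc m) c (s≤s c≤m) =
      ParksAt-deterministic {i = c} (ParksAt-cong agree (parks c)) (parks′ c)
      where
      agree : AgreeBelow (toℕ c) pos pos′
      agree d d<c = agreeBelow m d (≤-trans d<c c≤m)

  -- The invariant of the process once the cars numbered below `m` have parked. The values of `pos`
  -- at the cars still to come are arbitrary.
  record Holds (σ : Lot n) (pos : Fin n → Fin n) (m : ℕ) : Set where
    field
      sound    : ∀ {k c} → lookup σ k ≡ just c → toℕ c < m × pos c ≡ k
      complete : ∀ {c} → toℕ c < m → lookup σ (pos c) ≡ just c
  open Holds

  Holds-empty : ∀ pos → Holds (replicate n nothing) pos 0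
  Holds-empty pos .sound {k} eq with () ← trans (sym (lookup-replicate k nothing)) eq
  Holds-empty pos .complete ()

  Holds-cong : ∀ {σ pos pos′ m} → AgreeBelow m pos pos′ → Holds σ pos m → Holds σ pos′ m
  Holds-cong agree h .sound eq with c<m , refl ← sound h eq = c<m , sym (agree _ c<m)
  Holds-cong {σ} agree h .complete c<m = subst (λ k → lookup σ k ≡ _) (agree _ c<m) (complete h c<m)

  -- Since the spot taken is `Free`, no earlier car stands there to be overwritten.
  Holds-park : ∀ {σ pos i} → Holds σ pos (toℕ i) → Free G pos i (pos i) →
               Holds (σ [ pos i ]≔ just i) pos (suc (toℕ i))
  Holds-park {σ} {pos} {i} h free .sound {k} {c} eq with k Finₚ.≟ pos i
  ... | yes refl with refl ← just-injective (trans (sym (lookup∘updateAt (pos i) σ)) eq) = ≤-refl , refl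
  ... | no k≢ with c<i , posc≡k ← sound h (trans (sym (lookup∘updateAt′ k (pos i) k≢ σ)) eq) =
    m<n⇒m<1+n c<i , posc≡k
  Holds-park {σ} {pos} {i} h free .complete {c} (s≤s c≤i) with m≤n⇒m<n∨m≡n c≤i
  ... | inj₁ c<i = trans (lookup∘updateAt′ (pos c) (pos i) (proj₁ (free c c<i)) σ) (complete h c<i)
  ... | inj₂ c≡i with refl ← toℕ-injective c≡i = lookup∘updateAt (pos i) σ

  Available⇔Free : ∀ {σ pos i} → Holds σ pos (toℕ i) → ∀ k → Available G σ i k ⇔ Free G pos i k
  Available⇔Free {σ} {pos} {i} h k = mk⇔ to from
    where
    to : Available G σ i k → Free G pos i k
    to (empty , friends) c c<i =
      (λ { refl → absurd (subst Is-nothing (complete h c<i) empty) }) ,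
      λ adj → unJust (subst (MaybeAll.All _) (complete h c<i) (friends (pos c) adj))
      where
      absurd : ∀ {c} → ¬ Is-nothing (just {A = Fin n} c)
      absurd (MaybeAll.just ())
      unJust : ∀ {P : Fin n → Set} {c} → MaybeAll.All P (just c) → P c
      unJust (MaybeAll.just Pc) = Pc
    from : Free G pos i k → Available G σ i k
    from free = empty , friends
      where
      empty : Is-nothing (lookup σ k)
      empty with lookup σ k in eq
      ... | nothing = MaybeAll.nothing
      ... | just c with c<i , refl ← sound h eq = contradiction refl (proj₁ (free c c<i))
      friends : ∀ j → Consecutive j k → MaybeAll.All (λ c → Graph.Adj G c i) (lookup σ j)
      friends j adj with lookup σ j in eq
      ... | nothing = MaybeAll.nothing
      ... | just c with c<i , refl ← sound h eq = MaybeAll.just (proj₂ (free c c<i) adj)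

  parkingSpot⁺ : ∀ {σ pos i q k} → Holds σ pos (toℕ i) → ParksAt G pos i q k →
                 parkingSpot G σ i q ≡ just k
  parkingSpot⁺ {k = k} h (q≤k , free , first) = find-tabulate⁺ _ id k
    (q≤k , ⇐ (Available⇔Free h k) free)
    λ { j j<k (q≤j , avail) → first j q≤j j<k (⇒ (Available⇔Free h j) avail) }

  parkingSpot⁻ : ∀ {σ pos i q k} → Holds σ pos (toℕ i) → parkingSpot G σ i q ≡ just k →
                 ParksAt G pos i q k
  parkingSpot⁻ h eq with k , refl , (q≤k , avail) , first ← find-tabulate⁻ _ id eq =
    q≤k , ⇒ (Available⇔Free h k) avail ,
    λ j q≤j j<k free → first j j<k (q≤j , ⇐ (Available⇔Free h j) free)

  module _ (p : Preference n) where

    step : Maybe (Lot n) → Fin n → Maybe (Lot n)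
    step s i = s >>= λ σ → park G σ i (lookup p i)

    foldl-step-nothing : ∀ is → foldl step nothing is ≡ nothing
    foldl-step-nothing Data.List.[]       = refl
    foldl-step-nothing (i Data.List.∷ is) = foldl-step-nothing is

    -- The cars still to come are `o`, `o + 1`, ..., listed by `f`; this form covers every tail of
    -- the list of all cars and so carries the induction.
    foldl-step⁺ : ∀ {pos} → Parking G pos p → ∀ {m} (f : Fin m → Fin n) o →
                  (∀ j → toℕ (f j) ≡ o + toℕ j) → ∀ {σ} → Holds σ pos o →
                  Is-just (foldl step (just σ) (tabulate f))
    foldl-step⁺ parks {zero} f o f≡ h = MaybeAny.just _
    foldl-step⁺ {pos} parks {suc m} f o f≡ {σ} h with refl ← trans (f≡ zero) (+-identityʳ o)
      rewrite parkingSpot⁺ h (parks (f zero)) =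
      foldl-step⁺ parks (f ∘ suc) (suc (toℕ (f zero)))
        (λ j → trans (f≡ (suc j)) (+-suc _ (toℕ j))) (Holds-park h (proj₁ (proj₂ (parks (f zero)))))

    -- The map of spots is built one car at a time. On entry `pos` is arbitrary from car `o` on;
    -- each entering car overwrites its own value, and `AgreeBelow` preserves what is known of the
    -- cars before it.
    foldl-step⁻ : ∀ {m} (f : Fin m → Fin n) o → (∀ j → toℕ (f j) ≡ o + toℕ j) → o + m ≡ n →
                  ∀ {σ pos} → Holds σ pos o → Is-just (foldl step (just σ) (tabulate f)) →
                  ∃ λ pos′ → AgreeBelow o pos pos′ ×
                             (∀ i → o ≤ toℕ i → ParksAt G pos′ i (lookup p i) (pos′ i))
    foldl-step⁻ {zero} f o f≡ o≡n {pos = pos} h _ =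
      pos , (λ _ _ → refl) ,
      λ i o≤i → contradiction (toℕ<n i) (≤⇒≯ (subst (_≤ toℕ i) (trans (sym (+-identityʳ o)) o≡n) o≤i))
    foldl-step⁻ {suc m} f o f≡ o+m≡n {σ} {pos} h isJust with refl ← trans (f≡ zero) (+-identityʳ o)
      with parkingSpot G σ (f zero) (lookup p (f zero)) in eq
    ... | nothing with () ← subst Is-just (foldl-step-nothing (tabulate (f ∘ suc))) isJust
    ... | just k = result
      where
      i₀ = f zero
      pos₁ = Vector.updateAt pos i₀ (const k)
      pos₁≡k : pos₁ i₀ ≡ k
      pos₁≡k = Vectorₚ.updateAt-updates i₀ pos
      agree₁ : AgreeBelow (toℕ i₀) pos pos₁
      agree₁ c c<i₀ = sym (Vectorₚ.updateAt-minimal c i₀ pos λ { refl → <-irrefl refl c<i₀ })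
      parks₁ : ParksAt G pos₁ i₀ (lookup p i₀) (pos₁ i₀)
      parks₁ = subst (ParksAt G pos₁ i₀ _) (sym pos₁≡k) (ParksAt-cong agree₁ (parkingSpot⁻ h eq))
      h₁ : Holds (σ [ k ]≔ just i₀) pos₁ (suc (toℕ i₀))
      h₁ = subst (λ k → Holds (σ [ k ]≔ just i₀) pos₁ _) pos₁≡k
             (Holds-park (Holds-cong agree₁ h) (proj₁ (proj₂ parks₁)))
      rest = foldl-step⁻ (f ∘ suc) (suc (toℕ i₀)) (λ j → trans (f≡ (suc j)) (+-suc _ (toℕ j)))
               (trans (sym (+-suc _ m)) o+m≡n) h₁ isJust
      pos′ = proj₁ rest
      agree′ : AgreeBelow (suc (toℕ i₀)) pos₁ pos′
      agree′ = proj₁ (proj₂ rest)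
      result : ∃ λ pos′ → AgreeBelow (toℕ i₀) pos pos′ ×
                          (∀ i → toℕ i₀ ≤ toℕ i → ParksAt G pos′ i (lookup p i) (pos′ i))
      result = pos′ , (λ c c<i₀ → trans (agree₁ c c<i₀) (agree′ c (m<n⇒m<1+n c<i₀))) , parks′
        where
        parks′ : ∀ i → toℕ i₀ ≤ toℕ i → ParksAt G pos′ i (lookup p i) (pos′ i)
        parks′ i i₀≤i with m≤n⇒m<n∨m≡n i₀≤i
        ... | inj₁ i₀<i = proj₂ (proj₂ rest) i i₀<i
        ... | inj₂ i₀≡i with refl ← toℕ-injective i₀≡i =
          subst (ParksAt G pos′ i₀ _) (agree′ i₀ ≤-refl)
            (ParksAt-cong (λ c c<i₀ → agree′ c (m<n⇒m<1+n c<i₀)) parks₁)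

    outcome⁺ : ∀ {pos} → Parking G pos p → Is-just (outcome G p)
    outcome⁺ {pos} parks = foldl-step⁺ parks id 0 (λ _ → refl) (Holds-empty pos)

    outcome⁻ : Is-just (outcome G p) → ∃ λ pos → Parking G pos p
    outcome⁻ isJust
      -- Any map can serve as the initial one, as the empty lot imposes nothing on it; `lookup p` is
      -- one of the right type.
      with pos , _ , parks ← foldl-step⁻ id 0 (λ _ → refl) refl (Holds-empty (lookup p)) isJust =
      pos , λ i → parks i z≤n

-- Hamiltonian paths of the cycle

-- Pigeonhole: if `k` were missed, punching it out of the codomain would give an injection of
-- `Fin (suc n)` into `Fin n`.
injective⇒surjective : ∀ {n} {f : Fin n → Fin n} → Injective _≡_ _≡_ f → ∀ k → ∃ λ i → f i ≡ k
injective⇒surjective {suc n} {f} f-inj k with any? (λ i → f i Finₚ.≟ k)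
... | yes hit = hit
... | no miss = contradiction (injective⇒≤ {f = λ i → punchOut (λ eq → miss (i , sym eq))}
                  λ eq → f-inj (punchOut-injective (λ e → miss (_ , sym e)) _ eq)) (<⇒≱ ≤-refl)

module _ {n : ℕ} where

  -- Successor modulo `n`: the cycle with one of its two orientations. Unlike adjacency it is
  -- functional and injective.
  Next : Rel (Fin n) 0ℓ
  Next i j = suc (toℕ i) ≡ toℕ j ⊎ LastFirst i j

  cycleAdj⇒next : ∀ {i j} → CycleAdj i j → Next i j ⊎ Next j i
  cycleAdj⇒next (inj₁ (inj₁ e)) = inj₁ (inj₁ e)
  cycleAdj⇒next (inj₁ (inj₂ e)) = inj₂ (inj₁ e)
  cycleAdj⇒next (inj₂ (inj₁ l)) = inj₁ (inj₂ l)
  cycleAdj⇒next (inj₂ (inj₂ l)) = inj₂ (inj₂ l)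

  next⇒cycleAdj : ∀ {i j} → Next i j → CycleAdj i j
  next⇒cycleAdj (inj₁ e) = inj₁ (inj₁ e)
  next⇒cycleAdj (inj₂ l) = inj₂ (inj₁ l)

  cycleAdj-sym : ∀ {i j : Fin n} → CycleAdj i j → CycleAdj j i
  cycleAdj-sym (inj₁ c) = inj₁ (swap c)
  cycleAdj-sym (inj₂ l) = inj₂ (swap l)

  next-functional : ∀ {i j k} → Next i j → Next i k → j ≡ k
  next-functional (inj₁ e) (inj₁ e′) = toℕ-injective (trans (sym e) e′)
  next-functional {j = j} (inj₁ e) (inj₂ (e′ , _)) = contradiction (trans (sym e) e′) (<⇒≢ (toℕ<n j))
  next-functional {k = k} (inj₂ (e , _)) (inj₁ e′) = contradiction (trans (sym e′) e) (<⇒≢ (toℕ<n k))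
  next-functional (inj₂ (_ , z)) (inj₂ (_ , z′)) = toℕ-injective (trans z (sym z′))

  next-injective : ∀ {i j k} → Next i k → Next j k → i ≡ j
  next-injective (inj₁ e) (inj₁ e′) = toℕ-injective (suc-injective (trans e (sym e′)))
  next-injective (inj₁ e) (inj₂ (_ , z)) = contradiction (trans e z) λ ()
  next-injective (inj₂ (_ , z)) (inj₁ e) = contradiction (trans e z) λ ()
  next-injective (inj₂ (e , _)) (inj₂ (e′ , _)) = toℕ-injective (suc-injective (trans e (sym e′)))

-- The arrangements in which all cars have parked: inj₁ c and inj₂ c stand for
-- c, c + 1, c + 2, … and c, c - 1, c - 2, … modulo n, read along the spots.

Arrangement : ℕ → Set
Arrangement n = Fin n ⊎ Fin n

-- k is b - a modulo n, for k < n.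
data Shift (n a k b : ℕ) : Set where
  direct  : a + k ≡ b     → Shift n a k b
  wrapped : a + k ≡ b + n → Shift n a k b

-- Arrangements seen from the cars: car `j` is on spot `j - c`, respectively `c - j`, modulo `n`.
-- Stating this with `Shift` avoids modular arithmetic.
Realises : ∀ {n} → Arrangement n → (Fin n → Fin n) → Set
Realises {n} (inj₁ c) pos = ∀ j → Shift n (toℕ c) (toℕ (pos j)) (toℕ j)
Realises {n} (inj₂ c) pos = ∀ j → Shift n (toℕ j) (toℕ (pos j)) (toℕ c)

Shift-unique : ∀ {n a b k k′} → k < n → k′ < n →
                 Shift n a k b → Shift n a k′ b → k ≡ k′
Shift-unique {n} {a} {b} {k} {k′} k<n k′<n = λ where
    (direct e) (direct e′) → +-cancelˡ-≡ a k k′ (trans e (sym e′))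
    (direct e) (wrapped e′) → contradiction k′<n (too-big e e′)
    (wrapped e) (direct e′) → contradiction k<n (too-big e′ e)
    (wrapped e) (wrapped e′) → +-cancelˡ-≡ a k k′ (trans e (sym e′))
  where
  too-big : ∀ {x y} → a + x ≡ b → a + y ≡ b + n → ¬ y < n
  too-big {x} {y} e e′ y<n = m+n≮m n x (subst (_< n) y≡n+x y<n)
    where
    y≡n+x : y ≡ n + x
    y≡n+x = +-cancelˡ-≡ a y (n + x) (trans e′ (trans (cong (_+ n) (sym e)) (xy∙z≈x∙zy a x n)))

Realises-unique : ∀ {n} r {pos pos′ : Fin n → Fin n} → Realises r pos → Realises r pos′ → pos ≗ pos′
Realises-unique (inj₁ c) {pos} {pos′} re re′ j =
  toℕ-injective (Shift-unique (toℕ<n (pos j)) (toℕ<n (pos′ j)) (re j) (re′ j))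
Realises-unique (inj₂ c) {pos} {pos′} re re′ j =
  toℕ-injective (Shift-unique (toℕ<n (pos j)) (toℕ<n (pos′ j)) (re j) (re′ j))

module _ {n : ℕ} {pos : Fin n → Fin n} (pos-inj : Injective _≡_ _≡_ pos)
         (adj : ∀ {i j} → suc (toℕ (pos i)) ≡ toℕ (pos j) → CycleAdj i j) where

  private
    carAt : ∀ {k} → k < n → ∃ λ i → toℕ (pos i) ≡ k
    carAt k<n with i , e ← injective⇒surjective pos-inj (fromℕ< k<n) =
      i , trans (cong toℕ e) (toℕ-fromℕ< k<n)

    toℕ-pos-inj : ∀ {i j} → toℕ (pos i) ≡ toℕ (pos j) → i ≡ j
    toℕ-pos-inj = pos-inj ∘ toℕ-injective

  -- A path in the cycle cannot turn back, since it would revisit a vertex.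
  keeps-direction : (R : Rel (Fin n) 0ℓ) → (∀ {i j} → CycleAdj i j → R i j ⊎ R j i) →
    (∀ {i j k} → R i j → R k j → i ≡ k) →
    ∀ {i₀ i₁} → toℕ (pos i₀) ≡ 0 → toℕ (pos i₁) ≡ 1 → R i₀ i₁ →
    ∀ k {i j} → toℕ (pos i) ≡ k → toℕ (pos j) ≡ suc k → R i j
  keeps-direction R split R-inj e₀ e₁ r zero ei ej
    with refl ← toℕ-pos-inj (trans e₀ (sym ei)) | refl ← toℕ-pos-inj (trans e₁ (sym ej)) = r
  keeps-direction R split R-inj e₀ e₁ r (suc k) {i} {j} ei ej
    with split (adj (trans (cong suc ei) (sym ej)))
  ... | inj₁ Rij = Rij
  -- The car `h` one spot before `i` satisfies `R h i`. Together with `R j i` this makes `h` and `j`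
  -- the same car, although their spots differ by two.
  ... | inj₂ Rji with h , eh ← carAt (<-trans (n<1+n k) (subst (_< n) ei (toℕ<n (pos i))))
    with refl ← R-inj (keeps-direction R split R-inj e₀ e₁ r k eh ei) Rji =
    contradiction (trans (sym eh) ej) (<⇒≢ (m<n⇒m<1+n (n<1+n k)))

  private
    ascending : ∀ {c} → toℕ (pos c) ≡ 0 →
      (∀ {i j} → suc (toℕ (pos i)) ≡ toℕ (pos j) → Next i j) → Realises (inj₁ c) pos
    ascending {c} ec next j = go (toℕ (pos j)) refl
      where
      go : ∀ k {j} → toℕ (pos j) ≡ k → Shift n (toℕ c) k (toℕ j)
      go zero ej with refl ← toℕ-pos-inj (trans ec (sym ej)) = direct (+-identityʳ _)
      go (suc k) {j} ej
        with i , ei ← carAt (<-trans (n<1+n k) (subst (_< n) ej (toℕ<n (pos j))))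
        with go k ei | next {i} {j} (trans (cong suc ei) (sym ej))
      ... | direct e | inj₁ i→j = direct (trans (+-suc _ k) (trans (cong suc e) i→j))
      ... | direct e | inj₂ (i≡last , j≡0) =
        wrapped (trans (+-suc _ k) (trans (cong suc e) (trans i≡last (cong (_+ n) (sym j≡0)))))
      ... | wrapped e | inj₁ i→j = wrapped (trans (+-suc _ k) (trans (cong suc e) (cong (_+ n) i→j)))
      -- Wrapping a second time would require `c + suc k` to equal `n + n`, while both summands are
      -- below `n`.
      ... | wrapped e | inj₂ (i≡last , _) = contradiction
        (trans (+-suc _ k) (trans (cong suc e) (cong (_+ n) i≡last)))
        (<⇒≢ (+-mono-< (toℕ<n c) (subst (_< n) ej (toℕ<n (pos j)))))

    descending : ∀ {c} → toℕ (pos c) ≡ 0 →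
      (∀ {i j} → suc (toℕ (pos i)) ≡ toℕ (pos j) → Next j i) → Realises (inj₂ c) pos
    descending {c} ec next j = go (toℕ (pos j)) refl
      where
      go : ∀ k {j} → toℕ (pos j) ≡ k → Shift n (toℕ j) k (toℕ c)
      go zero ej with refl ← toℕ-pos-inj (trans ec (sym ej)) = direct (+-identityʳ _)
      go (suc k) {j} ej
        with i , ei ← carAt (<-trans (n<1+n k) (subst (_< n) ej (toℕ<n (pos j))))
        with go k ei | next {i} {j} (trans (cong suc ei) (sym ej))
      ... | direct e | inj₁ j→i = direct (trans (+-suc _ k) (trans (cong (_+ k) j→i) e))
      ... | wrapped e | inj₁ j→i = wrapped (trans (+-suc _ k) (trans (cong (_+ k) j→i) e))
      ... | direct e | inj₂ (j≡last , i≡0) =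
        wrapped (trans (+-suc _ k) (trans (cong (_+ k) j≡last)
          (trans (+-comm n k) (cong (_+ n) (trans (cong (_+ k) (sym i≡0)) e)))))
      ... | wrapped e | inj₂ (_ , i≡0) = contradiction
        (trans (cong (_+ k) (sym i≡0)) e)
        (<⇒≢ (<-≤-trans (<-trans (n<1+n k) (subst (_< n) ej (toℕ<n (pos j)))) (m≤n+m n (toℕ c))))

  -- The cars on the first two spots fix a direction round the cycle, which every later step keeps;
  -- the car on the first spot then fixes the rotation. The descending case is the ascending
  -- argument for the converse of `Next`.
  hamiltonian⇒realises : 1 < n → ∃ λ r → Realises r pos
  hamiltonian⇒realises 1<n
    with c , ec ← carAt (<-trans (s≤s z≤n) 1<n) | d , ed ← carAt 1<n
    with cycleAdj⇒next (adj {c} {d} (trans (cong suc ec) (sym ed)))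
  ... | inj₁ c→d = inj₁ c , ascending ec λ e →
    keeps-direction Next cycleAdj⇒next next-injective ec ed c→d _ refl (sym e)
  ... | inj₂ d→c = inj₂ c , descending ec λ e →
    keeps-direction (flip Next) (swap ∘ cycleAdj⇒next) next-functional ec ed d→c _ refl (sym e)


-- Existence and distinctness of the arrangements

Shift-exists : ∀ {n a b} → a < n → b < n → ∃ λ k → k < n × Shift n a k b
Shift-exists {n} {a} {b} a<n b<n with a ≤? b
... | yes a≤b = b ∸ a , ≤-<-trans (m∸n≤m b a) b<n , direct (m+[n∸m]≡n a≤b)
... | no a≰b = b + (n ∸ a) ,
  subst (b + (n ∸ a) <_) (m+[n∸m]≡n (<⇒≤ a<n)) (+-monoˡ-< (n ∸ a) (≰⇒> a≰b)) ,
  wrapped (trans (x∙yz≈y∙xz a b (n ∸ a)) (cong (b +_) (m+[n∸m]≡n (<⇒≤ a<n))))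
arrange : ∀ {n} (r : Arrangement n) → ∃ λ pos → Realises r pos
arrange {n} (inj₁ c) = (λ j → fromℕ< (proj₁ (proj₂ (shift j)))) ,
  λ j → subst (λ k → Shift n _ k _) (sym (toℕ-fromℕ< _)) (proj₂ (proj₂ (shift j)))
  where
  shift : (j : Fin n) → _
  shift j = Shift-exists (toℕ<n c) (toℕ<n j)
arrange {n} (inj₂ c) = (λ j → fromℕ< (proj₁ (proj₂ (shift j)))) ,
  λ j → subst (λ k → Shift n _ k _) (sym (toℕ-fromℕ< _)) (proj₂ (proj₂ (shift j)))
  where
  shift : (j : Fin n) → _
  shift j = Shift-exists (toℕ<n j) (toℕ<n c)

spots : ∀ {n} → Arrangement n → Fin n → Fin n
spots = proj₁ ∘ arrange

Realises-spots : ∀ {n} (r : Arrangement n) → Realises r (spots r)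
Realises-spots = proj₂ ∘ arrange

Shift-self : ∀ {n a k} → k < n → Shift n a k a → k ≡ 0
Shift-self {n} {a} {k} k<n s = Shift-unique k<n (≤-<-trans z≤n k<n) s (direct (+-identityʳ a))

Shift-0 : ∀ {n a b} → a < n → Shift n a 0 b → a ≡ b
Shift-0 a<n (direct e) = trans (sym (+-identityʳ _)) e
Shift-0 {n} {a} {b} a<n (wrapped e) =
  contradiction (subst (_< n) (trans (sym (+-identityʳ a)) e) a<n) (m+n≮n b n)

module _ {n : ℕ} {pos pos′ : Fin n → Fin n} (pos≗ : pos ≗ pos′) where

  private
    first : ∀ c → toℕ (pos c) ≡ 0 → toℕ (pos′ c) ≡ 0
    first c e = trans (cong toℕ (sym (pos≗ c))) e

  -- The car on the first spot is `c` in one description and `d` in the other.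
  ascending-injective : ∀ {c d} → Realises (inj₁ c) pos → Realises (inj₁ d) pos′ → c ≡ d
  ascending-injective {c} {d} rc rd = sym (toℕ-injective (Shift-0 (toℕ<n d)
    (subst (λ k → Shift n _ k _) (first c (Shift-self (toℕ<n _) (rc c))) (rd c))))

  descending-injective : ∀ {c d} → Realises (inj₂ c) pos → Realises (inj₂ d) pos′ → c ≡ d
  descending-injective {c} {d} rc rd = toℕ-injective (Shift-0 (toℕ<n c)
    (subst (λ k → Shift n _ k _) (first c (Shift-self (toℕ<n _) (rc c))) (rd c)))

  -- Both would begin with the same car `c`. A cyclic neighbour `j` of `c`, namely car 1 if `c` is 0
  -- and car `c - 1` otherwise, would then be on spot 1 as well as on spot `n - 1`, forcing `n` to
  -- be 2.
  ascending≢descending : 3 ≤ n → ∀ {c d} → Realises (inj₁ c) pos → ¬ Realises (inj₂ d) pos′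
  ascending≢descending 3≤n {c} {d} rc rd with refl ← toℕ-injective (Shift-0 (toℕ<n c)
    (subst (λ k → Shift n _ k _) (first c (Shift-self (toℕ<n _) (rc c))) (rd c))) = clash (toℕ c) refl
    where
    clash : ∀ x → ¬ toℕ c ≡ x
    clash zero ec = absurd (subst₂ (λ a b → Shift n a (toℕ (pos j)) b) ec ej (rc j))
        (subst₂ (Shift n 1) (cong toℕ (sym (pos≗ j))) ec (subst (λ a → Shift n a (toℕ (pos′ j)) (toℕ c)) ej (rd j)))
      where
      1<n : 1 < n
      1<n = <-trans ≤-refl 3≤n
      j = fromℕ< 1<n
      ej : toℕ j ≡ 1
      ej = toℕ-fromℕ< 1<n
      absurd : ∀ {k} → Shift n 0 k 1 → ¬ Shift n 1 k 0
      absurd (direct refl) (wrapped e) = <⇒≢ 3≤n e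
      absurd (wrapped refl) (wrapped e) = <⇒≢ (m<n⇒m<1+n (n<1+n n)) (sym e)
    clash (suc x) ec = absurd (subst₂ (λ a b → Shift n a (toℕ (pos j)) b) ec ej (rc j))
        (subst₂ (Shift n x) (cong toℕ (sym (pos≗ j))) ec (subst (λ a → Shift n a (toℕ (pos′ j)) (toℕ c)) ej (rd j)))
      where
      x<n : x < n
      x<n = <-trans (n<1+n x) (subst (_< n) ec (toℕ<n c))
      j = fromℕ< x<n
      ej : toℕ j ≡ x
      ej = toℕ-fromℕ< x<n
      absurd : ∀ {k} → Shift n (suc x) k x → ¬ Shift n x k (suc x)
      absurd {k} (direct e) _ = <⇒≢ (s≤s (m≤m+n x k)) (sym e)
      absurd {k} (wrapped e) (direct e′) with refl ← +-cancelˡ-≡ x k 1 (trans e′ (+-comm 1 x)) =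
        <⇒≢ 3≤n (+-cancelˡ-≡ x 2 n (trans (+-suc x 1) e))
      absurd {k} (wrapped e) (wrapped e′) = <⇒≢ (m<n⇒m<1+n (n<1+n _)) (trans (sym e) (cong suc e′))

Realises-injective : ∀ {n} → 3 ≤ n → ∀ {r r′} {pos pos′ : Fin n → Fin n} →
                     pos ≗ pos′ → Realises r pos → Realises r′ pos′ → r ≡ r′
Realises-injective 3≤n {inj₁ c} {inj₁ d} pos≗ rc rd = cong inj₁ (ascending-injective pos≗ rc rd)
Realises-injective 3≤n {inj₁ c} {inj₂ d} pos≗ rc rd = contradiction rd (ascending≢descending pos≗ 3≤n rc)
Realises-injective 3≤n {inj₂ c} {inj₁ d} pos≗ rc rd = contradiction rc (ascending≢descending (sym ∘ pos≗) 3≤n rd)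
Realises-injective 3≤n {inj₂ c} {inj₂ d} pos≗ rc rd = cong inj₂ (descending-injective pos≗ rc rd)

-- Outcomes of the process are arrangements

module _ {n : ℕ} (3≤n : 3 ≤ n) where

  Parking⇒injective : ∀ {pos p} → Parking (cycle n 3≤n) pos p → Injective _≡_ _≡_ pos
  Parking⇒injective parks {i} {j} e with <-cmp (toℕ i) (toℕ j)
  ... | tri< i<j _ _ = contradiction e (proj₁ (proj₁ (proj₂ (parks j)) i i<j))
  ... | tri≈ _ i≡j _ = toℕ-injective i≡j
  ... | tri> _ _ j<i = contradiction (sym e) (proj₁ (proj₁ (proj₂ (parks i)) j j<i))

  -- Of two cars on neighbouring spots, the later could park only because the earlier was its
  -- friend.
  Parking⇒friends : ∀ {pos p} → Parking (cycle n 3≤n) pos p → ∀ {i j} → Consecutive (pos i) (pos j) → CycleAdj i j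
  Parking⇒friends parks {i} {j} e with <-cmp (toℕ i) (toℕ j)
  ... | tri< i<j _ _ = proj₂ (proj₁ (proj₂ (parks j)) i i<j) e
  ... | tri> _ _ j<i = cycleAdj-sym (proj₂ (proj₁ (proj₂ (parks i)) j j<i) (swap e))
  ... | tri≈ _ i≡j _ with refl ← toℕ-injective i≡j = contradiction e [ 1+n≢n , 1+n≢n ]′

  Parking⇒Realises : ∀ {pos p} → Parking (cycle n 3≤n) pos p → ∃ λ r → Realises r pos
  Parking⇒Realises {p = p} parks =
    hamiltonian⇒realises (Parking⇒injective {p = p} parks) (Parking⇒friends {p = p} parks ∘ inj₁) (<-trans ≤-refl 3≤n)

-- Windows of preferences leading to a given spot

-- The preferences with which car i parks on pos i are that spot and the w - 1
-- spots before it.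
record Window {n} (G : Graph n) (pos : Fin n → Fin n) (i : Fin n) (w : ℕ) : Set where
  field
    positive  : 1 ≤ w
    fits      : w ≤ suc (toℕ (pos i))
    available : Free G pos i (pos i)
    blocked   : ∀ k → toℕ k < toℕ (pos i) → toℕ (pos i) < toℕ k + w → ¬ Free G pos i k
    opening   : ∀ k → toℕ k + w ≡ toℕ (pos i) → Free G pos i k

  parksAt⇔ : ∀ q → ParksAt G pos i q (pos i) ⇔ (toℕ q ≤ toℕ (pos i) × toℕ (pos i) < toℕ q + w)
  parksAt⇔ q = mk⇔ to from
    where
    to : ParksAt G pos i q (pos i) → toℕ q ≤ toℕ (pos i) × toℕ (pos i) < toℕ q + w
    to (q≤k , _ , first) = q≤k , ≰⇒> λ q+w≤k →
      -- Spot `j` lies just before the window and is free, so a preference at or before `j` would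
      -- stop the car no later than there.
      let j     = toℕ (pos i) ∸ w
          w≤k   = ≤-trans (m≤n+m w (toℕ q)) q+w≤k
          j+w≡k = m∸n+n≡m w≤k
          j<k   = subst (j <_) j+w≡k (m<m+n j positive)
          j<n   = <-trans j<k (toℕ<n (pos i))
          ej    = toℕ-fromℕ< j<n
      in first (fromℕ< j<n)
           (subst (toℕ q ≤_) (sym ej) (+-cancelʳ-≤ w (toℕ q) j (subst (toℕ q + w ≤_) (sym j+w≡k) q+w≤k)))
           (subst (_< toℕ (pos i)) (sym ej) j<k)
           (opening (fromℕ< j<n) (trans (cong (_+ w) ej) j+w≡k))
    from : toℕ q ≤ toℕ (pos i) × toℕ (pos i) < toℕ q + w → ParksAt G pos i q (pos i)
    from (q≤k , k<q+w) = q≤k , available ,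
      λ j q≤j j<k → blocked j j<k (<-≤-trans k<q+w (+-monoˡ-≤ w q≤j))

-- The second sequence is counted from the seam, so that a product over the whole splits into two
-- products over initial segments.
splice : ℕ → (ℕ → ℕ) → (ℕ → ℕ) → ℕ → ℕ
splice zero    f g i       = g i
splice (suc m) f g zero    = f zero
splice (suc m) f g (suc i) = splice m (f ∘ suc) g i

splice-< : ∀ {m f g i} → i < m → splice m f g i ≡ f i
splice-< {suc m} {i = zero}  _         = refl
splice-< {suc m} {i = suc i} (s≤s i<m) = splice-< {m} i<m

splice-+ : ∀ m {f g} t → splice m f g (m + t) ≡ g t
splice-+ zero    t = refl
splice-+ (suc m) t = splice-+ m t

module _ {n : ℕ} (3≤n : 3 ≤ n) where

  occupied : ∀ {pos i k} c → c <ᶠ i → toℕ (pos c) ≡ toℕ k → ¬ Free (cycle n 3≤n) pos i k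
  occupied c c<i e free = proj₁ (free c c<i) (toℕ-injective e)

  distant⇒Free : ∀ {pos i k} →
    (∀ c → c <ᶠ i → suc (toℕ (pos c)) < toℕ k ⊎ suc (toℕ k) < toℕ (pos c)) → Free (cycle n 3≤n) pos i k
  distant⇒Free distant c c<i with distant c c<i
  ... | inj₁ c<k = (λ { refl → 1+n≰n (<⇒≤ c<k) }) ,
    λ { (inj₁ e) → contradiction e (<⇒≢ c<k)
      ; (inj₂ e) → contradiction (≤-<-trans (n≤1+n _) c<k) (<⇒≯ (≤-reflexive e)) }
  ... | inj₂ k<c = (λ { refl → 1+n≰n (<⇒≤ k<c) }) ,
    λ { (inj₁ e) → contradiction (≤-<-trans (n≤1+n _) k<c) (<⇒≯ (≤-reflexive e))
      ; (inj₂ e) → contradiction e (<⇒≢ k<c) }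

  -- The only friends of car 0 are car 1 and the last car. Every empty spot shown below to be closed
  -- is closed for this reason.
  stranger : ∀ {c i : Fin n} → toℕ c ≡ 0 → 2 ≤ toℕ i → suc (toℕ i) < n → ¬ CycleAdj c i
  stranger {c} {i} c≡0 2≤i _ (inj₁ (inj₁ e)) rewrite c≡0 = <⇒≢ 2≤i e
  stranger {c} {i} c≡0 _ _ (inj₁ (inj₂ e)) rewrite c≡0 with () ← e
  stranger {c} {i} _ 2≤i _ (inj₂ (inj₁ (_ , z))) rewrite z with () ← 2≤i
  stranger {c} {i} _ _ i+1<n (inj₂ (inj₂ (e , _))) = <⇒≢ i+1<n e

  wrapped⇒next : ∀ {i j : Fin n} → suc (toℕ i) ≡ toℕ j + n → Next i j
  wrapped⇒next {i} {j} e = inj₂ (trans e (cong (_+ n) j≡0) , j≡0)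
    where
    j≡0 : toℕ j ≡ 0
    j≡0 = n≤0⇒n≡0 (+-cancelʳ-≤ n (toℕ j) 0 (subst (_≤ n) e (toℕ<n i)))

  -- Distinct cars have distinct spots, and cars on neighbouring spots are successive on the cycle,
  -- so no earlier car can close to `i` its own spot.
  Realises⇒available : ∀ r {pos} → Realises r pos → ∀ i → Free (cycle n 3≤n) pos i (pos i)
  Realises⇒available (inj₁ a) {pos} re i c c<i =
    (λ e → <⇒≢ c<i (functional (re c) (subst (λ k → Shift n (toℕ a) (toℕ k) (toℕ i)) (sym e) (re i)))) ,
    λ { (inj₁ e) → next⇒cycleAdj (next (re c) (subst (λ k → Shift n (toℕ a) k (toℕ i)) (sym e) (re i)))
      ; (inj₂ e) → cycleAdj-sym (next⇒cycleAdj
          (next (re i) (subst (λ k → Shift n (toℕ a) k (toℕ c)) (sym e) (re c)))) }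
    where
    functional : ∀ {k} {i j : Fin n} → Shift n (toℕ a) k (toℕ i) → Shift n (toℕ a) k (toℕ j) → toℕ i ≡ toℕ j
    functional (direct e) (direct e′) = trans (sym e) e′
    functional {i = i} {j} (direct e) (wrapped e′) =
      contradiction (subst (_< n) (trans (sym e) e′) (toℕ<n i)) (m+n≮n (toℕ j) n)
    functional {i = i} {j} (wrapped e) (direct e′) =
      contradiction (subst (_< n) (trans (sym e′) e) (toℕ<n j)) (m+n≮n (toℕ i) n)
    functional {i = i} {j} (wrapped e) (wrapped e′) = +-cancelʳ-≡ n (toℕ i) (toℕ j) (trans (sym e) e′)
    next : ∀ {k} {i j : Fin n} → Shift n (toℕ a) k (toℕ i) → Shift n (toℕ a) (suc k) (toℕ j) → Next i j
    next {k} (direct e) (direct e′) = inj₁ (trans (cong suc (sym e)) (trans (sym (+-suc _ k)) e′))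
    next {k} (direct e) (wrapped e′) = wrapped⇒next (trans (cong suc (sym e)) (trans (sym (+-suc _ k)) e′))
    next {k} {i} {j} (wrapped e) (direct e′) =
      contradiction (subst (_< n) (trans (sym e′) (trans (+-suc _ k) (cong suc e))) (toℕ<n j))
        (m+n≮n (suc (toℕ i)) n)
    next {k} {i} {j} (wrapped e) (wrapped e′) = inj₁ (+-cancelʳ-≡ n (suc (toℕ i)) (toℕ j)
      (trans (cong suc (sym e)) (trans (sym (+-suc _ k)) e′)))
  Realises⇒available (inj₂ a) {pos} re i c c<i =
    (λ e → <⇒≢ c<i (Shift-unique (toℕ<n c) (toℕ<n i) (Shift-comm (re c))
      (Shift-comm (subst (λ k → Shift n (toℕ i) (toℕ k) (toℕ a)) (sym e) (re i))))) ,
    λ { (inj₁ e) → cycleAdj-sym (next⇒cycleAdj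
          (next (re c) (subst (λ k → Shift n (toℕ i) k (toℕ a)) (sym e) (re i))))
      ; (inj₂ e) → next⇒cycleAdj (next (re i) (subst (λ k → Shift n (toℕ c) k (toℕ a)) (sym e) (re c))) }
    where
    Shift-comm : ∀ {i k} → Shift n i k (toℕ a) → Shift n k i (toℕ a)
    Shift-comm {i} {k} (direct e)  = direct (trans (+-comm k i) e)
    Shift-comm {i} {k} (wrapped e) = wrapped (trans (+-comm k i) e)
    next : ∀ {k} {i j : Fin n} → Shift n (toℕ j) k (toℕ a) → Shift n (toℕ i) (suc k) (toℕ a) → Next i j
    next {k} {i} {j} (direct e) (direct e′) = inj₁ (+-cancelʳ-≡ k _ _
      (trans (sym (+-suc (toℕ i) k)) (trans e′ (sym e))))
    next {k} {i} {j} (direct e) (wrapped e′) = wrapped⇒next (+-cancelʳ-≡ k _ _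
      (trans (sym (+-suc (toℕ i) k)) (trans e′ (trans (cong (_+ n) (sym e)) (xy∙z≈xz∙y (toℕ j) k n)))))
    next {k} {i} {j} (wrapped e) (direct e′) = contradiction (toℕ<n j) (subst (λ x → ¬ x < n) (sym j≡)
        (m+n≮n (suc (toℕ i)) n))
      where
      j≡ : toℕ j ≡ suc (toℕ i) + n
      j≡ = +-cancelʳ-≡ k _ _ (trans e (trans (cong (_+ n) (trans (sym e′) (+-suc (toℕ i) k)))
             (xy∙z≈xz∙y (suc (toℕ i)) k n)))
    next {k} {i} {j} (wrapped e) (wrapped e′) = inj₁ (+-cancelʳ-≡ k _ _
      (trans (sym (+-suc (toℕ i) k)) (trans e′ (sym e))))

-- Window lengths in the ascending rotations

-- From the third car on, the spot before that of car 0 is closed as well: it is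
-- empty, but next to a car that is not a friend.
lowWidth : ℕ → ℕ
lowWidth 0             = 1
lowWidth 1             = 2
lowWidth (suc (suc i)) = 4 + i

-- The count restarts at car `m`, which is on the first spot: car `m + t` is on spot `t` and may
-- prefer any of the `t + 1` spots up to it.
ascendingWidth : ℕ → ℕ → ℕ
ascendingWidth m = splice m lowWidth suc

module Ascending {m s : ℕ} (3≤n : 3 ≤ m + s) (m<n : m < m + s)
  {pos : Fin (m + s) → Fin (m + s)} (re : ∀ j → Shift (m + s) m (toℕ (pos j)) (toℕ j)) where

  private
    n = m + s

    high : ∀ {j} t → toℕ j ≡ m + t → toℕ (pos j) ≡ t
    high {j} t ej = Shift-unique (toℕ<n (pos j))
      (≤-<-trans (m≤n+m t m) (subst (_< n) ej (toℕ<n j))) (re j) (direct (sym ej))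

    low : ∀ {j} → toℕ j < m → toℕ (pos j) ≡ toℕ j + s
    low {j} j<m = Shift-unique (toℕ<n (pos j)) (+-monoˡ-< s j<m) (re j) (wrapped (x∙yz≈y∙xz m (toℕ j) s))

    0<s : 0 < s
    0<s = +-cancelˡ-< m 0 s (subst (_< n) (sym (+-identityʳ m)) m<n)

    car : ∀ {i c} → c < toℕ i → ∃ λ (j : Fin n) → toℕ j ≡ c
    car {i} c<i = fromℕ< (<-trans c<i (toℕ<n i)) , toℕ-fromℕ< _

    Width : Fin n → ℕ → Set
    Width i w = Window (cycle n 3≤n) pos i w

  highWindow : ∀ {i} t → toℕ i ≡ m + t → Free (cycle n 3≤n) pos i (pos i) → Width i (suc t)
  highWindow {i} t ei avail = record
    { positive  = s≤s z≤n
    ; fits      = s≤s (≤-reflexive (sym (high t ei)))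
    ; available = avail
    ; blocked   = λ k k<t _ → blocked k (subst (toℕ k <_) (high t ei) k<t)
    -- The window reaches back to the first spot, so no spot precedes it.
    ; opening   = λ k e → contradiction (trans (sym (high t ei)) (sym e)) (<⇒≢ (m≤n+m (suc t) (toℕ k)))
    }
    where
    blocked : ∀ k → toℕ k < t → ¬ Free (cycle n 3≤n) pos i k
    blocked k k<t
      with c<i ← subst (m + toℕ k <_) (sym ei) (+-monoʳ-< m k<t)
      with c , ec ← car {i} c<i =
      occupied 3≤n c (subst (_< toℕ i) (sym ec) c<i) (high (toℕ k) ec)

  -- The cars before `i` occupy a run of spots starting at `s`, where car 0 is. Spot `s - 1` is
  -- empty and next to car 0: open to car 1, closed to later cars below `m`, none of which is the
  -- last car. Spot `s - 2`, if there is one, has only empty neighbours.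
  lowWindow : ∀ {i} x → toℕ i ≡ x → x < m → Free (cycle n 3≤n) pos i (pos i) →
              Width i (ascendingWidth m x)
  lowWindow {i} x ei x<m avail = subst (Width i) (sym (splice-< x<m)) (window x ei x<m)
    where
    pos≡ : ∀ {y} → toℕ i ≡ y → y < m → toℕ (pos i) ≡ y + s
    pos≡ refl = low
    window : ∀ y → toℕ i ≡ y → y < m → Width i (lowWidth y)
    window 0 ei 0<m = record
      { positive  = s≤s z≤n
      ; fits      = s≤s z≤n
      ; available = avail
      ; blocked   = λ k k< <k+1 → contradiction (subst (toℕ (pos i) <_) (+-comm (toℕ k) 1) <k+1) (≤⇒≯ k<)
      ; opening   = λ k _ c c<i → contradiction (subst (toℕ c <_) ei c<i) λ ()
      }
    window 1 ei 1<m = record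
      { positive  = s≤s z≤n
      ; fits      = s≤s (subst (1 ≤_) (sym (pos≡ ei 1<m)) (s≤s z≤n))
      ; available = avail
      ; blocked   = blocked
      ; opening   = opening
      }
      where
      blocked : ∀ k → toℕ k < toℕ (pos i) → toℕ (pos i) < toℕ k + 2 → ¬ Free (cycle n 3≤n) pos i k
      blocked k k<p p<k+2 rewrite pos≡ ei 1<m
        with c , ec ← car {i} {0} (subst (0 <_) (sym ei) (s≤s z≤n)) =
        occupied 3≤n c (subst₂ _<_ (sym ec) (sym ei) (s≤s z≤n))
          (trans (low (subst (_< m) (sym ec) (<-trans (s≤s z≤n) 1<m)))
            (trans (cong (_+ s) ec) (≤-antisym
              (s≤s⁻¹ (s≤s⁻¹ (subst (2 + s ≤_) (+-comm (toℕ k) 2) p<k+2))) (s≤s⁻¹ k<p))))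
      opening : ∀ k → toℕ k + 2 ≡ toℕ (pos i) → Free (cycle n 3≤n) pos i k
      -- Here `k` is `s - 1`, and the only earlier car, car 0, is a friend of car 1.
      opening k e c c<i with ec ← n≤0⇒n≡0 (s≤s⁻¹ (subst (toℕ c <_) ei c<i)) =
        (λ pc≡k → <⇒≢ (n<1+n _) (trans (sym (cong toℕ pc≡k)) (sym k+1≡pc))) ,
        λ _ → inj₁ (inj₁ (trans (cong suc ec) (sym ei)))
        where
        k+1≡pc : suc (toℕ k) ≡ toℕ (pos c)
        k+1≡pc = trans (suc-injective (trans (+-comm 2 (toℕ k)) (trans e (pos≡ ei 1<m))))
          (sym (trans (low (subst (_< m) (sym ec) (<-trans (s≤s z≤n) 1<m))) (cong (_+ s) ec)))
    window (suc (suc y)) ei y<m = record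
      { positive  = s≤s z≤n
      ; fits      = s≤s (subst (3 + y ≤_) (sym (pos≡ ei y<m))
                      (subst (_≤ 2 + y + s) (+-comm (2 + y) 1) (+-monoʳ-≤ (2 + y) 0<s)))
      ; available = avail
      ; blocked   = blocked
      ; opening   = opening
      }
      where
      0<m : 0 < m
      0<m = <-trans (s≤s z≤n) y<m
      blocked : ∀ k → toℕ k < toℕ (pos i) → toℕ (pos i) < toℕ k + (4 + y) → ¬ Free (cycle n 3≤n) pos i k
      blocked k k<p p<k+w with s ≤? toℕ k
      ... | yes s≤k
        with u+s≡k ← m∸n+n≡m s≤k
        with u<2+y ← +-cancelʳ-< s (toℕ k ∸ s) (2 + y) (subst₂ _<_ (sym u+s≡k) (pos≡ ei y<m) k<p)
        with c , ec ← car {i} (subst (toℕ k ∸ s <_) (sym ei) u<2+y) =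
        occupied 3≤n c (subst₂ _<_ (sym ec) (sym ei) u<2+y)
          (trans (low (subst (_< m) (sym ec) (<-trans u<2+y y<m))) (trans (cong (_+ s) ec) u+s≡k))
      -- The bounds leave only `k = s - 1`, the empty spot before car 0.
      ... | no s≰k
        with c , ec ← car {i} {0} (subst (0 <_) (sym ei) (s≤s z≤n)) = λ free →
        stranger 3≤n ec (subst (2 ≤_) (sym ei) (s≤s (s≤s z≤n)))
          (subst (λ x → suc x < n) (sym ei) (≤-<-trans y<m m<n))
          (proj₂ (free c (subst₂ _<_ (sym ec) (sym ei) (s≤s z≤n)))
            (inj₂ (trans (≤-antisym (≰⇒> s≰k) s≤1+k)
              (sym (trans (low (subst (_< m) (sym ec) 0<m)) (cong (_+ s) ec))))))
        where
        s≤1+k : s ≤ suc (toℕ k)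
        s≤1+k = +-cancelˡ-≤ (3 + y) s (suc (toℕ k)) (subst₂ _≤_ (cong suc (pos≡ ei y<m)) (rearrange (toℕ k) y) p<k+w)
          where
          rearrange : ∀ k y → k + (4 + y) ≡ 3 + y + suc k
          rearrange = solve-∀
      opening : ∀ k → toℕ k + (4 + y) ≡ toℕ (pos i) → Free (cycle n 3≤n) pos i k
      opening k e = distant⇒Free 3≤n λ c c<i → inj₂ (≤-trans (≤-reflexive k+2≡s)
        (subst (s ≤_) (sym (low (<-trans (subst (toℕ c <_) ei c<i) y<m))) (m≤n+m s (toℕ c))))
        where
        rearrange : ∀ k y → 2 + y + (2 + k) ≡ k + (4 + y)
        rearrange = solve-∀
        k+2≡s : 2 + toℕ k ≡ s
        k+2≡s = +-cancelˡ-≡ (2 + y) (2 + toℕ k) s (trans (rearrange (toℕ k) y) (trans e (pos≡ ei y<m)))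

  window : ∀ i → Free (cycle n 3≤n) pos i (pos i) → Width i (ascendingWidth m (toℕ i))
  window i avail with m ≤? toℕ i
  ... | no m≰i = lowWindow (toℕ i) refl (≰⇒> m≰i) avail
  ... | yes m≤i with t , e ← m≤n⇒∃[o]m+o≡n m≤i =
    subst (Width i) (trans (sym (splice-+ m t)) (cong (ascendingWidth m) e)) (highWindow t (sym e) avail)

-- Window lengths in the descending rotations

-- Indexed by the number of cars still to come.  The car before the last is not a
-- friend of car 0, whose right-hand neighbour is therefore closed to it; earlier
-- cars find the spot before theirs available.
lastWidth : ℕ → ℕ → ℕ
lastWidth c 0             = 2 + c
lastWidth c 1             = 3 + c
lastWidth c (suc (suc _)) = 1

-- Here `b` is the number of cars above `c`; after car `c + 1 + t` there are `b ∸ suc t` still to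
-- come.
descendingWidth : ℕ → ℕ → ℕ → ℕ
descendingWidth c b = splice (suc c) (const 1) (λ t → lastWidth c (b ∸ suc t))

module Descending {a b : ℕ} (4≤n : 4 ≤ suc a + b) (3≤n : 3 ≤ suc a + b)
  {pos : Fin (suc a + b) → Fin (suc a + b)} (re : ∀ j → Shift (suc a + b) (toℕ j) (toℕ (pos j)) a) where

  private
    n = suc a + b

    a<n : a < n
    a<n = s≤s (m≤m+n a b)

    low : ∀ {j} k → toℕ j + k ≡ a → toℕ (pos j) ≡ k
    low {j} k e = Shift-unique (toℕ<n (pos j)) (≤-<-trans (subst (k ≤_) e (m≤n+m k (toℕ j))) a<n)
      (re j) (direct e)

    high : ∀ {j} u → a < toℕ j → toℕ j + suc u ≡ n → toℕ (pos j) ≡ suc (a + u)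
    high {j} u a<j e = Shift-unique (toℕ<n (pos j)) a+u<n (re j)
        (wrapped (trans (rearrange (toℕ j) a u) (cong (a +_) e)))
      where
      rearrange : ∀ j a u → j + suc (a + u) ≡ a + (j + suc u)
      rearrange = solve-∀
      a+u<n : suc (a + u) < n
      a+u<n = subst₂ _≤_ (cong suc (+-suc a u)) e (+-monoˡ-≤ (suc u) a<j)

    car : ∀ {i c} → c < toℕ i → ∃ λ (j : Fin n) → toℕ j ≡ c
    car {i} c<i = fromℕ< (<-trans c<i (toℕ<n i)) , toℕ-fromℕ< _

    Width : Fin n → ℕ → Set
    Width i w = Window (cycle n 3≤n) pos i w

  -- All earlier cars are on later spots, so the spot just before `pos i` has no occupied neighbour.
  lowWindow : ∀ {i} k → toℕ i + k ≡ a → Free (cycle n 3≤n) pos i (pos i) → Width i 1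
  lowWindow {i} k e avail = record
    { positive  = s≤s z≤n
    ; fits      = s≤s z≤n
    ; available = avail
    ; blocked   = λ j j<p p<j+1 → contradiction (subst (toℕ (pos i) <_) (+-comm (toℕ j) 1) p<j+1) (≤⇒≯ j<p)
    ; opening   = λ j e′ → distant⇒Free 3≤n λ c c<i → inj₂ (distant j e′ c c<i)
    }
    where
    distant : ∀ j → toℕ j + 1 ≡ toℕ (pos i) → ∀ c → c <ᶠ i → suc (toℕ j) < toℕ (pos c)
    distant j e′ c c<i with d , ed ← m≤n⇒∃[o]m+o≡n c<i =
      subst₂ _<_ (trans (sym (low k e)) (trans (sym e′) (+-comm (toℕ j) 1)))
        (sym (low (suc d + k) (trans (rearrange (toℕ c) d k) (trans (cong (_+ k) ed) e)))) (s≤s (m≤n+m k d))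
      where
      rearrange : ∀ c d k → c + (suc d + k) ≡ suc c + d + k
      rearrange = solve-∀

  -- When `i` enters, cars `a` to 0 fill the spots up to `a`, the other earlier cars are beyond
  -- `pos i`, and the `u` spots in between are empty. For `u = 1` the one empty spot is next to car
  -- 0 and closed; for larger `u` the spot just before `pos i` has no occupied neighbour.
  highWindow : ∀ {i} u → a < toℕ i → toℕ i + suc u ≡ n → Free (cycle n 3≤n) pos i (pos i) →
               Width i (lastWidth a u)
  highWindow {i} u a<i e avail = window u e
    where
    blocked-low : ∀ k → toℕ k ≤ a → ¬ Free (cycle n 3≤n) pos i k
    blocked-low k k≤a with c , ec ← car {i} (≤-<-trans (m∸n≤m a (toℕ k)) a<i) =
      occupied 3≤n c (subst (_< toℕ i) (sym ec) (≤-<-trans (m∸n≤m a (toℕ k)) a<i))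
        (low (toℕ k) (trans (cong (_+ toℕ k) ec) (m∸n+n≡m k≤a)))
    window : ∀ u → toℕ i + suc u ≡ n → Width i (lastWidth a u)
    window 0 e = record
      { positive  = s≤s z≤n
      ; fits      = s≤s (≤-reflexive (sym pos≡))
      ; available = avail
      ; blocked   = λ k k<p _ → blocked-low k (s≤s⁻¹ (subst (toℕ k <_) pos≡ k<p))
      ; opening   = λ k e′ → contradiction (trans (sym pos≡) (sym e′)) (<⇒≢ (m≤n+m (2 + a) (toℕ k)))
      }
      where
      pos≡ : toℕ (pos i) ≡ suc a
      pos≡ = trans (high 0 a<i e) (cong suc (+-identityʳ a))
    window 1 e = record
      { positive  = s≤s z≤n
      ; fits      = s≤s (≤-reflexive (sym pos≡))
      ; available = avail
      ; blocked   = λ k k<p _ → blocked k (s≤s⁻¹ (subst (toℕ k <_) pos≡ k<p))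
      ; opening   = λ k e′ → contradiction (trans (sym pos≡) (sym e′)) (<⇒≢ (m≤n+m (3 + a) (toℕ k)))
      }
      where
      pos≡ : toℕ (pos i) ≡ 2 + a
      pos≡ = trans (high 1 a<i e) (cong suc (+-comm a 1))
      2+i≡n : 2 + toℕ i ≡ n
      2+i≡n = trans (+-comm 2 (toℕ i)) e
      0<i : 0 < toℕ i
      0<i = ≤-<-trans z≤n a<i
      blocked : ∀ k → toℕ k ≤ suc a → ¬ Free (cycle n 3≤n) pos i k
      blocked k k≤1+a with m≤n⇒m<n∨m≡n k≤1+a | car {i} 0<i
      ... | inj₁ k≤a   | _ = blocked-low k (s≤s⁻¹ k≤a)
      ... | inj₂ k≡1+a | c , ec = λ free →
        -- The windows depend on `4 ≤ n` here: for `n = 3` the car before the last would be car 1, a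
        -- friend of car 0.
        stranger 3≤n ec (s≤s⁻¹ (s≤s⁻¹ (subst (4 ≤_) (sym 2+i≡n) 4≤n))) (≤-reflexive 2+i≡n)
          (proj₂ (free c (subst (_< toℕ i) (sym ec) 0<i))
            (inj₁ (trans (cong suc (low a (cong (_+ a) ec))) (sym k≡1+a))))
    window (suc (suc u)) e = record
      { positive  = s≤s z≤n
      ; fits      = s≤s z≤n
      ; available = avail
      ; blocked   = λ j j<p p<j+1 →
          contradiction (subst (toℕ (pos i) <_) (+-comm (toℕ j) 1) p<j+1) (≤⇒≯ j<p)
      ; opening   = λ k e′ → distant⇒Free 3≤n (distant k e′)
      }
      where
      pos≡ : toℕ (pos i) ≡ suc (a + (2 + u))
      pos≡ = high (2 + u) a<i e
      distant : ∀ k → toℕ k + 1 ≡ toℕ (pos i) →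
                ∀ c → c <ᶠ i → suc (toℕ (pos c)) < toℕ k ⊎ suc (toℕ k) < toℕ (pos c)
      distant k e′ c c<i with toℕ c ≤? a
      ... | yes c≤a = inj₁ (subst₂ _<_ (cong suc (sym (low (a ∸ toℕ c) (m+[n∸m]≡n c≤a)))) (sym k≡)
              (≤-<-trans (s≤s (m∸n≤m a (toℕ c)))
                (subst (_≤ a + (2 + u)) (+-comm a 2) (+-monoʳ-≤ a (s≤s (s≤s z≤n))))))
        where
        k≡ : toℕ k ≡ a + (2 + u)
        k≡ = suc-injective (trans (+-comm 1 (toℕ k)) (trans e′ pos≡))
      ... | no c≰a with d , ed ← m≤n⇒∃[o]m+o≡n c<i =
        inj₂ (subst₂ _<_ (trans (sym pos≡) (trans (sym e′) (+-comm (toℕ k) 1)))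
          (sym (high (suc d + (2 + u)) (≰⇒> c≰a)
            (trans (rearrange (toℕ c) d u) (trans (cong (_+ (3 + u)) ed) e))))
          (s≤s (+-monoʳ-< a (s≤s (m≤n+m (2 + u) d)))))
        where
        rearrange : ∀ c d u → c + suc (suc d + (2 + u)) ≡ suc c + d + (3 + u)
        rearrange = solve-∀

  window : ∀ i → Free (cycle n 3≤n) pos i (pos i) → Width i (descendingWidth a b (toℕ i))
  window i avail with suc a ≤? toℕ i
  ... | no a≮i = subst (Width i) (sym (splice-< {suc a} (≰⇒> a≮i)))
    (lowWindow (a ∸ toℕ i) (m+[n∸m]≡n (≮⇒≥ a≮i)) avail)
  ... | yes a<i with t , e ← m≤n⇒∃[o]m+o≡n a<i =
    subst (Width i) (trans (sym (splice-+ (suc a) {const 1} t)) (cong (descendingWidth a b) e))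
      (highWindow (b ∸ suc t) a<i
        (trans (cong (_+ suc (b ∸ suc t)) (sym e))
          (trans (+-assoc (suc a) t _) (cong (suc a +_) (trans (+-suc t _) (m+[n∸m]≡n t<b)))))
        avail)
    where
    t<b : t < b
    t<b = +-cancelˡ-< (suc a) t b (subst (_< n) (sym e) (toℕ<n i))

-- Mixed-radix digits and finite sums of types

-- Numerals in mixed radix, as nested pairs rather than dependent functions, so that pointwise equal
-- numerals are equal without function extensionality.
Digits : (ℕ → ℕ) → ℕ → Set
Digits w zero    = ⊤
Digits w (suc n) = Fin (w 0) × Digits (w ∘ suc) n

digit : ∀ {w n} → Digits w n → (i : Fin n) → Fin (w (toℕ i))
digit (d , _)  zero    = d
digit (_ , ds) (suc i) = digit ds i

digits : ∀ {w n} → ((i : Fin n) → Fin (w (toℕ i))) → Digits w n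
digits {n = zero}  f = tt
digits {n = suc n} f = f zero , digits (f ∘ suc)

digit∘digits : ∀ {w n} (f : (i : Fin n) → Fin (w (toℕ i))) i → digit (digits {w} f) i ≡ f i
digit∘digits f zero    = refl
digit∘digits {w} f (suc i) = digit∘digits {w ∘ suc} (f ∘ suc) i

digit-injective : ∀ {w n} {d e : Digits w n} → (∀ i → digit {w} d i ≡ digit {w} e i) → d ≡ e
digit-injective {n = zero}  eq = refl
digit-injective {w} {n = suc n} eq = cong₂ _,_ (eq zero) (digit-injective {w ∘ suc} (eq ∘ suc))

Digits↔Fin : ∀ w n → Digits w n ↔ Fin (product (applyUpTo w n))
Digits↔Fin w zero    = ↔-sym 1↔⊤
Digits↔Fin w (suc n) = ↔-sym *↔× ↔-∘ (↔-id _ ×-↔ Digits↔Fin (w ∘ suc) n)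

ΣFin↔Fin : ∀ {n} {B : Fin n → Set} (f : ℕ → ℕ) → (∀ i → B i ↔ Fin (f (toℕ i))) →
           Σ (Fin n) B ↔ Fin (sum (applyUpTo f n))
ΣFin↔Fin {zero}  f B↔ = mk↔ₛ′ (λ ()) (λ ()) (λ ()) (λ ())
ΣFin↔Fin {suc n} {B} f B↔ = ↔-sym +↔⊎ ↔-∘ ((B↔ zero ⊎-↔ ΣFin↔Fin (f ∘ suc) (B↔ ∘ suc)) ↔-∘ uncons)
  where
  uncons : Σ (Fin (suc n)) B ↔ (B zero ⊎ Σ (Fin n) (B ∘ suc))
  uncons = mk↔ₛ′ (λ { (zero , b) → inj₁ b ; (suc i , b) → inj₂ (i , b) })
                 (λ { (inj₁ b) → zero , b ; (inj₂ (i , b)) → suc i , b })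
                 (λ { (inj₁ _) → refl ; (inj₂ _) → refl })
                 (λ { (zero , _) → refl ; (suc _ , _) → refl })

Σ⊎↔ : {A B : Set} {C : A ⊎ B → Set} → Σ (A ⊎ B) C ↔ (Σ A (C ∘ inj₁) ⊎ Σ B (C ∘ inj₂))
Σ⊎↔ = mk↔ₛ′ (λ { (inj₁ a , c) → inj₁ (a , c) ; (inj₂ b , c) → inj₂ (b , c) })
            (λ { (inj₁ (a , c)) → inj₁ a , c ; (inj₂ (b , c)) → inj₂ b , c })
            (λ { (inj₁ _) → refl ; (inj₂ _) → refl })
            (λ { (inj₁ _ , _) → refl ; (inj₂ _ , _) → refl })

-- Evaluation of the products and sums

product-const-1 : ∀ n → product (applyUpTo (const 1) n) ≡ 1
product-const-1 zero    = refl
product-const-1 (suc n) = trans (*-identityˡ _) (product-const-1 n)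

product-splice : ∀ m s f g → product (applyUpTo (splice m f g) (m + s)) ≡
                 product (applyUpTo f m) * product (applyUpTo g s)
product-splice zero    s f g = sym (*-identityˡ _)
product-splice (suc m) s f g =
  trans (cong (f 0 *_) (product-splice m s (f ∘ suc) g)) (sym (*-assoc (f 0) _ _))

product-snoc : ∀ f n → product (applyUpTo f (suc n)) ≡ product (applyUpTo f n) * f n
product-snoc f zero    = *-comm (f 0) 1
product-snoc f (suc n) = trans (cong (f 0 *_) (product-snoc (f ∘ suc) n)) (sym (*-assoc (f 0) _ _))

sum-snoc : ∀ f n → sum (applyUpTo f (suc n)) ≡ sum (applyUpTo f n) + f n
sum-snoc f zero    = +-comm (f 0) 0
sum-snoc f (suc n) = trans (cong (f 0 +_) (sum-snoc (f ∘ suc) n)) (sym (+-assoc (f 0) _ _))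

sum-cong : ∀ {f g} n → (∀ i → i < n → f i ≡ g i) → sum (applyUpTo f n) ≡ sum (applyUpTo g n)
sum-cong zero    eq = refl
sum-cong (suc n) eq = cong₂ _+_ (eq 0 (s≤s z≤n)) (sum-cong n λ i i<n → eq (suc i) (s≤s i<n))

product-suc : ∀ n → product (applyUpTo suc n) ≡ n !
product-suc zero    = refl
product-suc (suc n) = trans (product-snoc suc n)
  (trans (cong (_* suc n) (product-suc n)) (*-comm (n !) (suc n)))

-- The factors 1, 2, 4, 5, ..., `4 + x` are those of the factorial with 3 left out. This is the
-- source of the division by 3 in the theorem.
3*product-lowWidth : ∀ x → product (applyUpTo lowWidth (3 + x)) * 3 ≡ (4 + x) !
3*product-lowWidth zero    = refl
3*product-lowWidth (suc x) = begin
  product (applyUpTo lowWidth (4 + x)) * 3              ≡⟨ cong (_* 3) (product-snoc lowWidth (3 + x)) ⟩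
  product (applyUpTo lowWidth (3 + x)) * (5 + x) * 3    ≡⟨ rearrange (product (applyUpTo lowWidth (3 + x))) (5 + x) ⟩
  (5 + x) * (product (applyUpTo lowWidth (3 + x)) * 3)  ≡⟨ cong ((5 + x) *_) (3*product-lowWidth x) ⟩
  (5 + x) !                                             ∎
  where
  open ≡-Reasoning
  rearrange : ∀ p q → p * q * 3 ≡ q * (p * 3)
  rearrange = solve-∀

-- Only the last two factors differ from 1.
product-lastWidth : ∀ c b → product (applyUpTo (λ t → lastWidth c ((2 + b) ∸ suc t)) (2 + b)) ≡ (3 + c) * (2 + c)
product-lastWidth c zero    = cong ((3 + c) *_) (*-identityʳ (2 + c))
product-lastWidth c (suc b) = trans (*-identityˡ _) (product-lastWidth c b)

ascendingCount : ℕ → ℕ → ℕ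
ascendingCount n m = product (applyUpTo (ascendingWidth m) n)

descendingCount : ℕ → ℕ → ℕ
descendingCount n c = product (applyUpTo (descendingWidth c (n ∸ suc c)) n)

ascendingCount-+ : ∀ m s → ascendingCount (m + s) m ≡ product (applyUpTo lowWidth m) * s !
ascendingCount-+ m s = trans (product-splice m s lowWidth suc)
  (cong (product (applyUpTo lowWidth m) *_) (product-suc s))

descendingCount-+ : ∀ c b → descendingCount (suc c + b) c ≡ product (applyUpTo (λ t → lastWidth c (b ∸ suc t)) b)
descendingCount-+ c b rewrite m+n∸m≡n c b =
  trans (product-splice (suc c) b (const 1) (λ t → lastWidth c (b ∸ suc t)))
    (trans (cong (_* product (applyUpTo (λ t → lastWidth c (b ∸ suc t)) b)) (product-const-1 (suc c))) (*-identityˡ _))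

-- The rotation starting with car `m` gives the term `i = m + 1`. For `m` up to 2 the product of the
-- low widths is `m !`, too short to miss the factor 3; from `m = 3` on it is a third of `i !`.
ascendingTotal : ∀ k → let n = 4 + k in
  sum (applyUpTo (ascendingCount n) n) ≡
  (∑[ i from 1 to 3 ] (n + 1 ∸ i) ! * (i ∸ 1) !) + (∑[ i from 4 to n ] (n ∸ i + 1) ! * i ! / 3)
ascendingTotal k = begin
  A 0 + (A 1 + (A 2 + sum (applyUpTo (A ∘ (3 +_)) (1 + k))))
    ≡⟨ cong₂ _+_ first (cong₂ _+_ second (cong₂ _+_ third (sum-cong (1 + k) bulk))) ⟩
  (n + 1 ∸ 1) ! * 0 ! + ((n + 1 ∸ 2) ! * 1 ! + ((n + 1 ∸ 3) ! * 2 ! + _))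
    ≡⟨ rearrange ((n + 1 ∸ 1) ! * 0 !) ((n + 1 ∸ 2) ! * 1 !) ((n + 1 ∸ 3) ! * 2 !) _ ⟩
  (∑[ i from 1 to 3 ] (n + 1 ∸ i) ! * (i ∸ 1) !) + (∑[ i from 4 to n ] (n ∸ i + 1) ! * i ! / 3) ∎
  where
  open ≡-Reasoning
  n = 4 + k
  A = ascendingCount n
  rearrange : ∀ x y z w → x + (y + (z + w)) ≡ x + (y + (z + 0)) + w
  rearrange = solve-∀
  first : A 0 ≡ (n + 1 ∸ 1) ! * 0 !
  first = trans (product-suc n)
    (trans (cong _! (+-comm 1 (3 + k))) (sym (*-identityʳ ((3 + k + 1) !))))
  second : A 1 ≡ (n + 1 ∸ 2) ! * 1 !
  second = trans (ascendingCount-+ 1 (3 + k))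
    (trans (*-comm 1 ((3 + k) !)) (cong (λ m → m ! * 1) (+-comm 1 (2 + k))))
  third : A 2 ≡ (n + 1 ∸ 3) ! * 2 !
  third = trans (ascendingCount-+ 2 (2 + k))
    (trans (*-comm 2 ((2 + k) !)) (cong (λ m → m ! * 2) (+-comm 1 (1 + k))))
  bulk : ∀ j → j < 1 + k → A (3 + j) ≡ (n ∸ (4 + j) + 1) ! * (4 + j) ! / 3
  bulk j (s≤s j≤k) = begin
    A (3 + j)                         ≡⟨ cong (λ n → ascendingCount n (3 + j)) n≡ ⟩
    ascendingCount (3 + j + t) (3 + j) ≡⟨ ascendingCount-+ (3 + j) t ⟩
    P * t !                           ≡⟨ m*n/n≡m (P * t !) 3 ⟨
    P * t ! * 3 / 3                   ≡⟨ cong (_/ 3) (shuffle P (t !)) ⟩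
    t ! * (P * 3) / 3                 ≡⟨ cong (λ x → t ! * x / 3) (3*product-lowWidth j) ⟩
    t ! * (4 + j) ! / 3               ∎
    where
    -- The number of cars from `3 + j` on, in the form to which `n ∸ i + 1` computes at `i = 4 + j`.
    t = k ∸ j + 1
    P = product (applyUpTo lowWidth (3 + j))
    shuffle : ∀ p q → p * q * 3 ≡ q * (p * 3)
    shuffle = solve-∀
    swap-suc : ∀ j d → 4 + (j + d) ≡ 3 + j + (d + 1)
    swap-suc = solve-∀
    n≡ : n ≡ 3 + j + t
    n≡ = trans (cong (4 +_) (sym (m+[n∸m]≡n j≤k))) (swap-suc j (k ∸ j))

-- For `c = n - 1` no car comes after the wrap and the count is 1; for `c = n - 2` only the last car
-- has a choice, among all `n` spots. Every smaller `c` has both final cars and gives the term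
-- `i = c + 1`.
descendingTotal : ∀ k → let n = 4 + k in
  sum (applyUpTo (descendingCount n) n) ≡ n + 1 + (∑[ i from 1 to n ∸ 2 ] (i + 1) * (i + 2))
descendingTotal k = begin
  sum (applyUpTo (descendingCount n) n)  ≡⟨ sum-snoc (descendingCount n) (3 + k) ⟩
  sum (applyUpTo (descendingCount n) (3 + k)) + descendingCount n (3 + k)
    ≡⟨ cong (_+ descendingCount n (3 + k)) (sum-snoc (descendingCount n) (2 + k)) ⟩
  sum (applyUpTo (descendingCount n) (2 + k)) + descendingCount n (2 + k) + descendingCount n (3 + k)
    ≡⟨ cong₂ _+_ (cong₂ _+_ (sum-cong (2 + k) bulk) beforeLast) last ⟩
  sum (applyUpTo (λ c → (suc c + 1) * (suc c + 2)) (2 + k)) + n + 1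
    ≡⟨ rearrange _ n ⟩
  n + 1 + sum (applyUpTo (λ c → (suc c + 1) * (suc c + 2)) (2 + k)) ∎
  where
  open ≡-Reasoning
  n = 4 + k
  rearrange : ∀ x n → x + n + 1 ≡ n + 1 + x
  rearrange = solve-∀
  last : descendingCount n (3 + k) ≡ 1
  last = trans (cong (λ n → descendingCount n (3 + k)) (sym (+-identityʳ n))) (descendingCount-+ (3 + k) 0)
  beforeLast : descendingCount n (2 + k) ≡ n
  beforeLast = trans (cong (λ n → descendingCount n (2 + k)) (+-comm 1 (3 + k)))
    (trans (descendingCount-+ (2 + k) 1) (*-identityʳ n))
  bulk : ∀ c → c < 2 + k → descendingCount n c ≡ (suc c + 1) * (suc c + 2)
  bulk c c<2+k with b , e ← m≤n⇒∃[o]m+o≡n c<2+k = begin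
    descendingCount n c                 ≡⟨ cong (λ n → descendingCount n c) n≡ ⟩
    descendingCount (suc c + (2 + b)) c ≡⟨ descendingCount-+ c (2 + b) ⟩
    _                                   ≡⟨ product-lastWidth c b ⟩
    (3 + c) * (2 + c)                   ≡⟨ expand c ⟩
    (suc c + 1) * (suc c + 2)           ∎
    where
    shuffle : ∀ c b → 2 + (suc c + b) ≡ suc c + (2 + b)
    shuffle = solve-∀
    n≡ : n ≡ suc c + (2 + b)
    n≡ = trans (cong (2 +_) (sym e)) (shuffle c b)
    expand : ∀ c → (3 + c) * (2 + c) ≡ (suc c + 1) * (suc c + 2)
    expand = solve-∀

-- The bijection between codes and friendship parking functions

width : ∀ {n} → Arrangement n → ℕ → ℕ
width     (inj₁ c) = ascendingWidth (toℕ c)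
width {n} (inj₂ c) = descendingWidth (toℕ c) (n ∸ suc (toℕ c))

module _ {n : ℕ} (4≤n : 4 ≤ n) (3≤n : 3 ≤ n) where

  private G = cycle n 3≤n

  Realises⇒Window : ∀ r {pos} → Realises r pos → ∀ i → Window G pos i (width r (toℕ i))
  Realises⇒Window (inj₁ c) re i =
    ascending (m+[n∸m]≡n (<⇒≤ (toℕ<n c))) 3≤n (toℕ<n c) re i (Realises⇒available 3≤n (inj₁ c) re i)
    where
    -- With `n` a variable, matching on `refl` turns it into the sum over which the window lemmas
    -- are stated.
    ascending : ∀ {m s n} → m + s ≡ n → ∀ 3≤n → m < n → ∀ {pos} →
      (∀ j → Shift n m (toℕ (pos j)) (toℕ j)) →
      ∀ i → Free (cycle n 3≤n) pos i (pos i) → Window (cycle n 3≤n) pos i (ascendingWidth m (toℕ i))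
    ascending refl = Ascending.window
  Realises⇒Window (inj₂ c) re i =
    descending (m+[n∸m]≡n (toℕ<n c)) 4≤n 3≤n re i (Realises⇒available 3≤n (inj₂ c) re i)
    where
    descending : ∀ {a b n} → suc a + b ≡ n → 4 ≤ n → ∀ 3≤n → ∀ {pos} →
      (∀ j → Shift n (toℕ j) (toℕ (pos j)) a) →
      ∀ i → Free (cycle n 3≤n) pos i (pos i) → Window (cycle n 3≤n) pos i (descendingWidth a b (toℕ i))
    descending refl = Descending.window

  private
    window : ∀ r i → Window G (spots r) i (width r (toℕ i))
    window r = Realises⇒Window r (Realises-spots r)

    Code : Set
    Code = Σ (Arrangement n) λ r → Digits (width r) n

    -- A digit is the distance of a preference from the spot finally taken.
    pref : Code → Fin n → Fin n
    pref (r , d) i = fromℕ<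
      (≤-<-trans (m∸n≤m (toℕ (spots r i)) (toℕ (digit {width r} d i))) (toℕ<n (spots r i)))

    toℕ-pref : ∀ r d i → toℕ (pref (r , d) i) ≡ toℕ (spots r i) ∸ toℕ (digit {width r} d i)
    toℕ-pref r d i = toℕ-fromℕ< _

    digit≤ : ∀ r d i → toℕ (digit {width r} d i) ≤ toℕ (spots r i)
    digit≤ r d i = s≤s⁻¹ (<-≤-trans (toℕ<n (digit {width r} d i)) (Window.fits (window r i)))

    parks : ∀ r d → Parking G (spots r) (Vec.tabulate (pref (r , d)))
    parks r d i rewrite lookup∘tabulate (pref (r , d)) i =
      ⇐ (Window.parksAt⇔ (window r i) (pref (r , d) i)) (q≤k , k<q+w)
      where
      k = toℕ (spots r i)
      δ = digit {width r} d i
      q≤k : toℕ (pref (r , d) i) ≤ k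
      q≤k = subst (_≤ k) (sym (toℕ-pref r d i)) (m∸n≤m k (toℕ δ))
      k<q+w : k < toℕ (pref (r , d) i) + width r (toℕ i)
      k<q+w = subst₂ (λ a b → a < b + width r (toℕ i)) (m∸n+n≡m (digit≤ r d i)) (sym (toℕ-pref r d i))
                (+-monoʳ-< (k ∸ toℕ δ) (toℕ<n δ))

    decode : Code → FPF G
    decode (r , d) = Vec.tabulate (pref (r , d)) , outcome⁺ G (Vec.tabulate (pref (r , d))) (parks r d)

    FPF-≡ : ∀ {f g : FPF G} → (∀ i → lookup (proj₁ f) i ≡ lookup (proj₁ g) i) → f ≡ g
    FPF-≡ {p , ok} {q , ok′} eq
      with refl ← trans (sym (tabulate∘lookup p)) (trans (tabulate-cong eq) (tabulate∘lookup q)) =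
      cong (p ,_) (MaybeAny.irrelevant (λ _ _ → refl) ok ok′)

    -- Equal preferences send the cars to equal spots, which determine the arrangement. The digits
    -- are then distances back from the same spots; none exceeds its spot, so truncated subtraction
    -- loses nothing.
    decode-injective : Injective _≡_ _≡_ decode
    decode-injective {r , d} {r′ , d′} eq
      with refl ← Realises-injective 3≤n {r} {r′}
             (Parking-unique G {p = Vec.tabulate (pref (r , d))} (parks r d)
               (subst (Parking G (spots r′)) (sym (cong proj₁ eq)) (parks r′ d′)))
             (Realises-spots r) (Realises-spots r′) =
      cong (r ,_) (digit-injective {width r} λ i → toℕ-injective (∸-cancelˡ-≡ (digit≤ r d i) (digit≤ r d′ i)
        (trans (sym (toℕ-pref r d i)) (trans (cong toℕ (same i)) (toℕ-pref r d′ i)))))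
      where
      same : ∀ i → pref (r , d) i ≡ pref (r′ , d′) i
      same i = trans (sym (lookup∘tabulate _ i)) (trans (cong (λ f → lookup (proj₁ f) i) eq) (lookup∘tabulate _ i))

    -- The spots reached from `p` realise some `r`, hence agree with `spots r`; the digit of a car
    -- is the distance from its preference to its spot, which its window bounds.
    decode-surjective : StrictlySurjective _≡_ decode
    decode-surjective (p , ok)
      with pos , parks-pos ← outcome⁻ G p ok
      with r , re ← Parking⇒Realises 3≤n {p = p} parks-pos = (r , d) , FPF-≡ same
      where
      k : Fin n → ℕ
      k = toℕ ∘ spots r
      inWindow : ∀ i → toℕ (lookup p i) ≤ k i × k i < toℕ (lookup p i) + width r (toℕ i)
      inWindow i with pos≡ ← Realises-unique r re (Realises-spots r) i =
        subst (λ s → toℕ (lookup p i) ≤ toℕ s × toℕ s < toℕ (lookup p i) + width r (toℕ i)) pos≡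
          (⇒ (Window.parksAt⇔ (Realises⇒Window r re i) (lookup p i)) (parks-pos i))
      δ<w : ∀ i → k i ∸ toℕ (lookup p i) < width r (toℕ i)
      δ<w i = +-cancelˡ-< (toℕ (lookup p i)) _ _
        (subst (_< toℕ (lookup p i) + width r (toℕ i)) (sym (m+[n∸m]≡n (proj₁ (inWindow i)))) (proj₂ (inWindow i)))
      d : Digits (width r) n
      d = digits λ i → fromℕ< (δ<w i)
      same : ∀ i → lookup (Vec.tabulate (pref (r , d))) i ≡ lookup p i
      same i = trans (lookup∘tabulate _ i) (toℕ-injective (trans (toℕ-pref r d i)
        (trans (cong (k i ∸_) (trans (cong toℕ (digit∘digits {width r} (λ i → fromℕ< (δ<w i)) i)) (toℕ-fromℕ< (δ<w i))))
          (m∸[m∸n]≡n (proj₁ (inWindow i))))))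

  FPF↔Fin : FPF G ↔ Fin (sum (applyUpTo (ascendingCount n) n) + sum (applyUpTo (descendingCount n) n))
  FPF↔Fin = ↔-sym +↔⊎ ↔-∘
    ((ΣFin↔Fin (ascendingCount n) (λ c → Digits↔Fin (width (inj₁ c)) n) ⊎-↔
      ΣFin↔Fin (descendingCount n) (λ c → Digits↔Fin (width {n} (inj₂ c)) n)) ↔-∘
    (Σ⊎↔ ↔-∘ ↔-sym (⤖⇒↔ (mk⤖ (decode-injective , strictlySurjective⇒surjective decode-surjective)))))

theorem2p10 : (n : ℕ) (4≤n : 4 ≤ n) →
    FPF (cycle n (≤-trans (n≤1+n 3) 4≤n)) ↔
    Fin (n + 1
    + (∑[ i from 1 to n ∸ 2 ] (i + 1) * (i + 2))
    + (∑[ i from 1 to 3 ] (n + 1 ∸ i) ! * (i ∸ 1) !)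
    + (∑[ i from 4 to n ] (n ∸ i + 1) ! * i ! / 3))
theorem2p10 n 4≤n = subst (λ N → FPF (cycle n (≤-trans (n≤1+n 3) 4≤n)) ↔ Fin N) (total 4≤n)
    (FPF↔Fin 4≤n (≤-trans (n≤1+n 3) 4≤n))
  where
  total : ∀ {n} → 4 ≤ n →
    sum (applyUpTo (ascendingCount n) n) + sum (applyUpTo (descendingCount n) n) ≡
    n + 1 + (∑[ i from 1 to n ∸ 2 ] (i + 1) * (i + 2))
      + (∑[ i from 1 to 3 ] (n + 1 ∸ i) ! * (i ∸ 1) !)
      + (∑[ i from 4 to n ] (n ∸ i + 1) ! * i ! / 3)
  -- The descending rotations supply the first part of the formula, up to the sum of
  -- `(i + 1) * (i + 2)`; the ascending ones supply the two sums with factorials.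
  total (s≤s (s≤s (s≤s (s≤s (z≤n {k}))))) = trans (+-comm (sum (applyUpTo (ascendingCount (4 + k)) (4 + k))) _)
    (trans (cong₂ _+_ (descendingTotal k) (ascendingTotal k))
      (sym (+-assoc (4 + k + 1 + (∑[ i from 1 to 2 + k ] (i + 1) * (i + 2)))
                    (∑[ i from 1 to 3 ] (4 + k + 1 ∸ i) ! * (i ∸ 1) !) _)))
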